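{- Let $n$ be a positive integer and let $\alpha\in\operatorname{Comp}(n)$. Then $$\eta_\alpha=2\sum_{\gamma\in\operatorname{Comp}(n)}(-1)^{|\operatorname{Des}(\gamma)\setminus\operatorname{Des}(\alpha)|}L_\gamma.$$
   Context: $\mathbf{k}$ is a fixed commutative ring; all functions below are power series in $\mathbf{k}[[x_1,x_2,\ldots]]$ (elements of the ring $\operatorname{QSym}$ of quasisymmetric functions). A composition of $n$ is a finite sequence $\alpha=(\alpha_1,\ldots,\alpha_p)$ of positive integers with sum $n$; its length is $\ell(\alpha)=p$, and $\operatorname{Comp}(n)$ is the set of compositions of $n$. For $\alpha\in\operatorname{Comp}(n)$, $\operatorname{Des}(\alpha)=\{\alpha_1,\alpha_1+\alpha_2,\ldots,\alpha_1+\cdots+\alpha_{p-1}\}\subseteq\{1,\ldots,n-1\}$. Monomial quasisymmetric function: $M_\alpha=\sum_{i_1<\cdots<i_p}x_{i_1}^{\alpha_1}\cdots x_{i_p}^{\alpha_p}$. Fundamental quasisymmetric function: $L_\alpha=\sum x_{i_1}x_{i_2}\cdots x_{i_n}$, summed over all $i_1\le\cdots\le i_n$ such that $i_j<i_{j+1}$ for every $j\in\operatorname{Des}(\alpha)$. (Indices are positive integers.) Enriched monomial function: $\eta_\alpha=\sum_{\beta\in\operatorname{Comp}(n),\ \operatorname{Des}(\beta)\subseteq\operatorname{Des}(\alpha)}2^{\ell(\beta)}M_\beta$. -}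

module Defs where

open import Algebra.Bundles using (CommutativeRing; Semiring)
import Algebra.Definitions.RawSemiring as RawSemiringDefinitions
open import Data.Empty using (⊥)
open import Data.Fin.Base using (Fin; toℕ)
import Data.Fin.Properties as Fin
open import Data.Fin.Subset using (Subset; _─_; ∣_∣)
  renaming (_∈_ to _∈ˢ_; _⊆_ to _⊆ˢ_)
open import Data.Fin.Subset.Properties using (_⊆?_) renaming (_∈?_ to _∈ˢ?_)
open import Data.List.Base
  using (List; []; _∷_; _++_; map; foldr; filter; length; replicate; upTo;
         cartesianProductWith)
open import Data.List.Extrema.Nat using (max; xs≤max)
open import Data.List.Membership.Propositional using (_∈_)
open import Data.List.Membership.Propositional.Properties
  using (∈-filter⁺; ∈-filter⁻; ∈-map⁺; ∈-map⁻; ∈-++⁺ˡ; ∈-++⁺ʳ; ∈-upTo⁺;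
         ∈-cartesianProductWith⁺)
open import Data.List.Membership.Propositional.Properties.WithK using (unique∧set⇒bag)
open import Data.List.Properties using (≡-dec)
open import Data.List.Relation.Binary.BagAndSetEquality using (∼bag⇒↭)
open import Data.List.Relation.Binary.Permutation.Propositional
  using (_↭_; ↭-refl; ↭-sym; ↭-trans; ↭-reflexive; ↭⇒↭ₛ)
open import Data.List.Relation.Binary.Permutation.Propositional.Properties
  using (↭-length; ∈-resp-↭)
import Data.List.Relation.Binary.Pointwise as Pointwise
open import Data.List.Relation.Unary.All as All using (All; []; _∷_)
open import Data.List.Relation.Unary.AllPairs using ([]; _∷_)
open import Data.List.Relation.Unary.Any using (here)
open import Data.List.Relation.Unary.Sorted.TotalOrder.Properties using (↗↭↗⇒≋)
open import Data.List.Relation.Unary.Unique.Propositional using (Unique)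
import Data.List.Relation.Unary.Unique.Propositional.Properties as Unique
open import Data.Nat.Base using (ℕ; zero; suc; _+_; _≤_; _<_; z<s; s≤s)
open import Data.Nat.ListAction using (sum)
open import Data.Nat.Properties
  using (_≟_; _<?_; _≤?_; ≡-irrelevant; <-irrelevant; suc-injective;
         ≤-totalOrder; ≤-decTotalOrder)
open import Data.List.Membership.DecPropositional _≟_ using (_∈?_)
open import Data.List.Sort.Base ≤-totalOrder using (module SortingAlgorithm)
open import Data.List.Sort.InsertionSort ≤-decTotalOrder using (insertionSort)
open SortingAlgorithm insertionSort using (sort; sort-↭; sort-↗)
open import Data.Product.Base using (_×_; _,_; proj₁; proj₂)
open import Data.Vec.Base as Vec using (Vec; []; _∷_; toList; lookup; tabulate)
import Data.Vec.Properties as Vec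
open import Data.Vec.Relation.Unary.All as VecAll using ([]; _∷_)
open import Data.Vec.Relation.Unary.Linked using (Linked; linked?)
open import Function.Base using (_∘_)
open import Function.Bundles using (_⇔_; mk⇔; Equivalence)
open import Level using (_⊔_)
open import Relation.Binary.Definitions using () renaming (Decidable to Decidable₂)
open import Relation.Binary.PropositionalEquality
  using (_≡_; refl; sym; cong; cong₂; subst)
open import Relation.Nullary.Decidable using (Dec; does; map′; _×-dec_; _→-dec_)
open import Relation.Unary using (Decidable)

record Composition (n : ℕ) : Set where
  constructor composition
  field
    parts    : List ℕ
    positive : All (0 <_) parts
    sum≡n    : sum parts ≡ n

  ℓ : ℕ
  ℓ = length parts

open Composition public

properPrefixSums : List ℕ → List ℕ
properPrefixSums []           = []
properPrefixSums (a ∷ [])     = []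
properPrefixSums (a ∷ b ∷ as) = a ∷ map (a +_) (properPrefixSums (b ∷ as))

-- A subset of {0, …, n-1}, with i : Fin n standing for the number toℕ i.
-- Since parts are positive, 0 is never a member.
Des : ∀ {n} → Composition n → Subset n
Des α = tabulate λ i → does (toℕ i ∈? properPrefixSums (parts α))

parts-injective : ∀ {n} {α β : Composition n} → parts α ≡ parts β → α ≡ β
parts-injective {α = composition as pos eq} {composition .as pos′ eq′} refl =
  cong₂ (composition as) (All.irrelevant <-irrelevant pos pos′) (≡-irrelevant eq eq′)

prepend : ∀ {n} → Composition n → Composition (suc n)
prepend (composition as pos eq) = composition (1 ∷ as) (z<s ∷ pos) (cong suc eq)

bump : ∀ {n} → Composition (suc n) → Composition (suc (suc n))
bump (composition (a ∷ as) (_ ∷ pos) eq) =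
  composition (suc a ∷ as) (z<s ∷ pos) (cong suc eq)

compositions : ∀ n → List (Composition n)
compositions zero          = composition [] [] refl ∷ []
compositions (suc zero)    = composition (1 ∷ []) (z<s ∷ []) refl ∷ []
compositions (suc (suc n)) =
  map prepend (compositions (suc n)) ++ map bump (compositions (suc n))

∈-compositions : ∀ {n} (α : Composition n) → α ∈ compositions n
∈-compositions {zero} (composition [] [] refl) = here refl
∈-compositions {zero} (composition (_ ∷ _) (s≤s _ ∷ _) ())
∈-compositions {suc zero} (composition (1 ∷ []) (_ ∷ []) refl) =
  here (parts-injective refl)
∈-compositions {suc zero} (composition (1 ∷ _ ∷ _) (_ ∷ s≤s _ ∷ _) ())
∈-compositions {suc (suc n)} (composition (1 ∷ as) (_ ∷ pos) eq) =
  subst (_∈ compositions (suc (suc n))) (parts-injective refl)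
    (∈-++⁺ˡ (∈-map⁺ prepend (∈-compositions (composition as pos (suc-injective eq)))))
∈-compositions {suc (suc n)} (composition (suc (suc a) ∷ as) (_ ∷ pos) eq) =
  subst (_∈ compositions (suc (suc n))) (parts-injective refl)
    (∈-++⁺ʳ (map prepend (compositions (suc n)))
      (∈-map⁺ bump
        (∈-compositions (composition (suc a ∷ as) (z<s ∷ pos) (suc-injective eq)))))

compositions-unique : ∀ n → Unique (compositions n)
compositions-unique zero          = [] ∷ []
compositions-unique (suc zero)    = [] ∷ []
compositions-unique (suc (suc n)) =
  Unique.++⁺ (Unique.map⁺ prepend-injective (compositions-unique (suc n)))
             (Unique.map⁺ bump-injective (compositions-unique (suc n)))
             disjoint
  where
  prepend-injective : ∀ {α β : Composition (suc n)} → prepend α ≡ prepend β → α ≡ β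
  prepend-injective eq with refl ← cong parts eq = parts-injective refl

  bump-injective : ∀ {α β : Composition (suc n)} → bump α ≡ bump β → α ≡ β
  bump-injective {composition (_ ∷ _) (_ ∷ _) _} {composition (_ ∷ _) (_ ∷ _) _} eq
    with refl ← cong parts eq = parts-injective refl

  prepend≢bump : ∀ (α β : Composition (suc n)) → prepend α ≡ bump β → ⊥
  prepend≢bump α (composition (suc b ∷ _) (_ ∷ _) _) eq with () ← cong parts eq

  disjoint : ∀ {γ} → γ ∈ map prepend (compositions (suc n)) ×
                     γ ∈ map bump (compositions (suc n)) → ⊥
  disjoint (γ∈l , γ∈r)
    with α , _ , γ≡α ← ∈-map⁻ prepend γ∈l
       | β , _ , refl ← ∈-map⁻ bump γ∈r = prepend≢bump α β (sym γ≡α)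

-- The free commutative monoid on the variables x₁, x₂, …: the word
-- i₁ ∷ … ∷ iₙ ∷ [] stands for the product of its variables, where i : ℕ is the
-- index of x_{i+1}.  Words are identified up to permutation, _↭_.
Monomial : Set
Monomial = List ℕ

infix 4 _↭?_

_↭?_ : Decidable₂ (_↭_ {A = ℕ})
m ↭? m′ = map′ from to (≡-dec _≟_ (sort m) (sort m′))
  where
  from : sort m ≡ sort m′ → m ↭ m′
  from eq = ↭-trans (↭-sym (sort-↭ m)) (↭-trans (↭-reflexive eq) (sort-↭ m′))

  to : m ↭ m′ → sort m ≡ sort m′
  to m↭m′ = Pointwise.Pointwise-≡⇒≡
    (↗↭↗⇒≋ ≤-totalOrder (sort-↗ m) (sort-↗ m′)
      (↭⇒↭ₛ (↭-trans (sort-↭ m) (↭-trans m↭m′ (↭-sym (sort-↭ m′))))))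

-- Summability of the family of monomials mon s, over all s satisfying P: each
-- monomial occurs only finitely often, the occurrences being listed by fibre.
record Summable {S : Set} (P : S → Set) (mon : S → Monomial) : Set where
  field
    fibre        : Monomial → List S
    fibre-unique : ∀ m → Unique (fibre m)
    ∈-fibre      : ∀ {m s} → s ∈ fibre m ⇔ (P s × mon s ↭ m)

  multiplicity : Monomial → ℕ
  multiplicity m = length (fibre m)

  multiplicity-cong : ∀ {m m′} → m ↭ m′ → multiplicity m ≡ multiplicity m′
  multiplicity-cong {m} {m′} m↭m′ =
    ↭-length (∼bag⇒↭ (unique∧set⇒bag (fibre-unique m) (fibre-unique m′)
      (mk⇔ (transport m↭m′) (transport (↭-sym m↭m′)))))
    where
    transport : ∀ {m m′ s} → m ↭ m′ → s ∈ fibre m → s ∈ fibre m′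
    transport m↭m′ s∈ =
      let Ps , mon↭m = Equivalence.to ∈-fibre s∈
      in Equivalence.from ∈-fibre (Ps , ↭-trans mon↭m m↭m′)

tuples : ∀ p → ℕ → List (Vec ℕ p)
tuples zero    N = [] ∷ []
tuples (suc p) N = cartesianProductWith _∷_ (upTo N) (tuples p N)

tuples-unique : ∀ p N → Unique (tuples p N)
tuples-unique zero    N = [] ∷ []
tuples-unique (suc p) N =
  Unique.cartesianProductWith⁺ _∷_ Vec.∷-injective (Unique.upTo⁺ N) (tuples-unique p N)

∈-tuples : ∀ {p N} {s : Vec ℕ p} → VecAll.All (_< N) s → s ∈ tuples p N
∈-tuples []       = here refl
∈-tuples (x ∷ xs) = ∈-cartesianProductWith⁺ _∷_ (∈-upTo⁺ x) (∈-tuples xs)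

summable : ∀ {p} {P : Vec ℕ p → Set} {mon : Vec ℕ p → Monomial} →
           Decidable P → (∀ s → VecAll.All (_∈ mon s) s) → Summable P mon
summable {p} {P} {mon} P? supported = record
  { fibre        = fibre
  ; fibre-unique = λ m → Unique.filter⁺ (Q? m) (tuples-unique p (bound m))
  ; ∈-fibre      = λ {m} → mk⇔ (proj₂ ∘ ∈-filter⁻ (Q? m) {xs = tuples p (bound m)})
                               (λ q → ∈-filter⁺ (Q? m) (∈-tuples (bounded q)) q)
  }
  where
  bound : Monomial → ℕ
  bound m = suc (max 0 m)

  Q? : ∀ m → Decidable (λ s → P s × mon s ↭ m)
  Q? m s = P? s ×-dec (mon s ↭? m)

  fibre : Monomial → List (Vec ℕ p)
  fibre m = filter (Q? m) (tuples p (bound m))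

  bounded : ∀ {m s} → P s × mon s ↭ m → VecAll.All (_< bound m) s
  bounded {m} {s} (_ , mon↭m) =
    VecAll.map (λ i∈ → s≤s (All.lookup (xs≤max 0 m) (∈-resp-↭ mon↭m i∈))) (supported s)

-- x_{i₁}^{e₁} ⋯ x_{iₚ}^{eₚ}
powers : (es : List ℕ) → Vec ℕ (length es) → Monomial
powers []       []      = []
powers (e ∷ es) (i ∷ s) = replicate e i ++ powers es s

StrictlyIncreasing : ∀ {p} → Vec ℕ p → Set
StrictlyIncreasing = Linked _<_

-- i₁ ≤ … ≤ iₙ with a strict step at every descent of α.  Entries are numbered
-- from 0, so the step from i_d to i_{d+1} is the one into entry k with toℕ k ≡ d.
IncreasingAlong : ∀ {n} → Composition n → Vec ℕ n → Set
IncreasingAlong α s =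
  Linked _≤_ s ×
  (∀ j k → suc (toℕ j) ≡ toℕ k → k ∈ˢ Des α → lookup s j < lookup s k)

increasingAlong? : ∀ {n} (α : Composition n) → Decidable (IncreasingAlong α)
increasingAlong? α s =
  linked? _≤?_ s ×-dec
  Fin.all? λ j → Fin.all? λ k →
    (suc (toℕ j) ≟ toℕ k) →-dec ((k ∈ˢ? Des α) →-dec (lookup s j <? lookup s k))

powers-summable : ∀ {n} (α : Composition n) →
                  Summable StrictlyIncreasing (powers (parts α))
powers-summable α = summable (linked? _<?_) (supported (positive α))
  where
  supported : ∀ {es} → All (0 <_) es → ∀ s → VecAll.All (_∈ powers es s) s
  supported []                        []      = []
  supported {suc e ∷ _} (s≤s _ ∷ pos) (i ∷ s) =
    here refl ∷ VecAll.map (∈-++⁺ʳ (replicate (suc e) i)) (supported pos s)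

toList-summable : ∀ {n} (α : Composition n) → Summable (IncreasingAlong α) toList
toList-summable α = summable (increasingAlong? α) supported
  where
  supported : ∀ {n} (s : Vec ℕ n) → VecAll.All (_∈ toList s) s
  supported []      = []
  supported (i ∷ s) = here refl ∷ VecAll.map (∈-++⁺ʳ (i ∷ [])) (supported s)

module QuasisymmetricFunctions {c ℓ′} (𝐤 : CommutativeRing c ℓ′) where

  private
    module 𝐤 = CommutativeRing 𝐤
    module Defs𝐤 = RawSemiringDefinitions (Semiring.rawSemiring 𝐤.semiring)

  open 𝐤 using (Carrier; _≈_; 0#; 1#)

  infixr 8 _^_
  _^_ : Carrier → ℕ → Carrier
  _^_ = Defs𝐤._^_

  2# : Carrier
  2# = 1# 𝐤.+ 1#

  -1# : Carrier
  -1# = 𝐤.- 1#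

  record PowerSeries : Set (c ⊔ ℓ′) where
    field
      coeff      : Monomial → Carrier
      coeff-cong : ∀ {m m′} → m ↭ m′ → coeff m ≈ coeff m′

  open PowerSeries public

  infix  4 _≋_
  infixl 6 _⊕_
  infixr 7 _·_

  _≋_ : PowerSeries → PowerSeries → Set ℓ′
  f ≋ g = ∀ m → coeff f m ≈ coeff g m

  𝟎 : PowerSeries
  𝟎 = record { coeff = λ _ → 0# ; coeff-cong = λ _ → 𝐤.refl }

  _⊕_ : PowerSeries → PowerSeries → PowerSeries
  f ⊕ g = record
    { coeff      = λ m → coeff f m 𝐤.+ coeff g m
    ; coeff-cong = λ eq → 𝐤.+-cong (coeff-cong f eq) (coeff-cong g eq)
    }

  _·_ : Carrier → PowerSeries → PowerSeries
  a · f = record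
    { coeff      = λ m → a 𝐤.* coeff f m
    ; coeff-cong = λ eq → 𝐤.*-congˡ (coeff-cong f eq)
    }

  ∑ : ∀ {a} {A : Set a} → List A → (A → PowerSeries) → PowerSeries
  ∑ xs f = foldr (λ x g → f x ⊕ g) 𝟎 xs

  -- The possibly infinite sum of mon s over all s satisfying P.
  ∑ᵐ : ∀ {S P mon} → Summable {S} P mon → PowerSeries
  ∑ᵐ F = record
    { coeff      = λ m → multiplicity m Defs𝐤.× 1#
    ; coeff-cong = λ eq → 𝐤.reflexive (cong (Defs𝐤._× 1#) (multiplicity-cong eq))
    }
    where open Summable F

  M : ∀ {n} → Composition n → PowerSeries
  M α = ∑ᵐ (powers-summable α)

  L : ∀ {n} → Composition n → PowerSeries
  L α = ∑ᵐ (toList-summable α)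

  η : ∀ {n} → Composition n → PowerSeries
  η {n} α = ∑ (filter (λ β → Des β ⊆? Des α) (compositions n)) λ β → 2# ^ ℓ β · M β

{-# OPTIONS --safe #-}
module Submission where

-- Fix a monomial of degree n with weakly increasing word w, and let T be the set
-- of positions at which w strictly increases.  Its coefficient in M_β is
-- [Des β = T] and in L_γ it is [Des γ ⊆ T].  Compositions of n correspond to
-- subsets of {1, …, n-1} through Des, so the coefficient of η_α is
-- [T ⊆ Des α] 2^(|T|+1), while the sum over γ factors over T into terms
-- 1 + (-1)^[t ∉ Des α], giving the same value after multiplication by 2.

open import Algebra.Bundles using (CommutativeRing)
import Algebra.Properties.CommutativeSemigroup as CommutativeSemigroupProperties
import Algebra.Properties.Ring as RingProperties
open import Data.Bool.Base using (Bool; true; false; if_then_else_)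
import Data.Bool.Properties as Bool
open import Data.Fin.Base using (zero; suc; toℕ; inject₁)
open import Data.Fin.Properties using (toℕ-inject₁; toℕ-injective)
open import Data.Fin.Subset using (Subset; _─_; ∣_∣; inside; outside)
  renaming (_∈_ to _∈ˢ_; _⊆_ to _⊆ˢ_)
open import Data.Fin.Subset.Properties using (_⊆?_)
open import Data.List.Base using (List; []; _∷_; _++_; map; foldr; filter; length; replicate)
open import Data.List.Membership.Propositional using (_∈_)
open import Data.List.Membership.Propositional.Properties using (∈-map⁺; ∈-map⁻)
open import Data.List.Properties
  using (∷-injectiveˡ; ∷-injectiveʳ; ++-cancelˡ; length-++; length-replicate; map-∘)
open import Data.List.Relation.Binary.Permutation.Propositional
  using (_↭_; ↭-sym; ↭-trans; ↭-reflexive; ↭⇒↭ₛ)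
open import Data.List.Relation.Binary.Permutation.Propositional.Properties using (↭-length)
import Data.List.Relation.Binary.Pointwise as Pointwise
open import Data.List.Relation.Unary.All using (All; []; _∷_)
open import Data.List.Relation.Unary.AllPairs using (_∷_)
open import Data.List.Relation.Unary.Any using (here; there)
import Data.List.Relation.Unary.Linked as List
open import Data.List.Relation.Unary.Sorted.TotalOrder.Properties using (↗↭↗⇒≋)
open import Data.Nat.Base using (ℕ; zero; suc; _+_; _≤_; _<_; z<s; s≤s; NonZero)
open import Data.Nat.ListAction using (sum)
open import Data.Nat.Properties
  using (_≟_; _<?_; suc-injective; ≤-antisym; ≤-refl; <⇒≤; <-irrefl; ≮⇒≥;
         ≤-totalOrder; ≤-decTotalOrder)
open import Data.List.Membership.DecPropositional _≟_ using (_∈?_)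
open import Data.List.Relation.Unary.Sorted.TotalOrder ≤-totalOrder using (Sorted)
open import Data.List.Sort.Base ≤-totalOrder using (module SortingAlgorithm)
open import Data.List.Sort.InsertionSort ≤-decTotalOrder using (insertionSort)
open SortingAlgorithm insertionSort using (sort; sort-↭; sort-↗)
open import Data.Product.Base using (∃-syntax; _×_; _,_; proj₁)
open import Data.Vec.Base as Vec using (Vec; []; _∷_; toList; fromList; lookup; tabulate)
open import Data.Vec.Properties
  using (≡-dec; cast-is-id; tabulate-cong; lookup∘tabulate; toList∘fromList;
         toList-injective; length-toList; []=⇒lookup; lookup⇒[]=)
open import Data.Vec.Relation.Unary.Linked using (Linked; []; [-]; _∷_)
open import Function.Base using (_∘_)
open import Function.Bundles using (_⇔_; mk⇔; Equivalence)
open import Relation.Binary.PropositionalEquality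
  using (_≡_; refl; sym; trans; cong; cong₂; subst)
open import Relation.Nullary using (Dec; does; yes; no; ¬_; contradiction)
open import Relation.Nullary.Decidable using (dec-true; dec-false; does-⇔)
open import Relation.Unary using (Decidable)
open import Defs

-- Descent sets and the inductive structure of compositions.

-- Des omits 0, so for a composition of n + 1 it amounts to a subset of {1, …, n};
-- here i : Fin n stands for the number toℕ i + 1.
descents : ∀ {n} → Composition (suc n) → Subset n
descents = Vec.tail ∘ Des

0∉properPrefixSums : ∀ {as} → All (0 <_) as → ¬ 0 ∈ properPrefixSums as
0∉properPrefixSums {suc a ∷ b ∷ as} (s≤s _ ∷ _) (there 0∈) with ∈-map⁻ (suc a +_) 0∈
... | _ , _ , ()

Des≡outside∷descents : ∀ {n} (γ : Composition (suc n)) → Des γ ≡ outside ∷ descents γ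
Des≡outside∷descents γ =
  cong (_∷ descents γ) (dec-false (0 ∈? properPrefixSums (parts γ)) (0∉properPrefixSums (positive γ)))

suc-∈?-map-suc : ∀ k as → does (suc k ∈? map suc as) ≡ does (k ∈? as)
suc-∈?-map-suc k as = does-⇔ (mk⇔ from (∈-map⁺ suc)) (suc k ∈? map suc as) (k ∈? as)
  where
  from : suc k ∈ map suc as → k ∈ as
  from k∈ with ∈-map⁻ suc k∈
  ... | _ , k∈as , refl = k∈as

-- A new first part 1 contributes the prefix sum 1 and raises all the others by one. Exposing the
-- head `suc a` of the old parts makes the prefix sums reduce.
descents-prepend : ∀ {n} (γ : Composition (suc n)) → descents (prepend γ) ≡ inside ∷ descents γ
descents-prepend (composition (suc a ∷ as) (_ ∷ _) _) =
  cong (inside ∷_) (tabulate-cong λ i → suc-∈?-map-suc (suc (toℕ i)) (properPrefixSums (suc a ∷ as)))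

properPrefixSums-bump : ∀ a as →
  properPrefixSums (suc a ∷ as) ≡ map suc (properPrefixSums (a ∷ as))
properPrefixSums-bump a []       = refl
properPrefixSums-bump a (b ∷ as) = cong (suc a ∷_) (map-∘ {g = suc} {a +_} (properPrefixSums (b ∷ as)))

-- Raising the first part shifts every prefix sum by one and adds none. Number 1 is the shifted 0,
-- which is never a descent, hence the leading `outside`.
descents-bump : ∀ {n} (γ : Composition (suc n)) → descents (bump γ) ≡ outside ∷ descents γ
descents-bump γ@(composition (a ∷ as) (_ ∷ _) _) =
  trans (tabulate-cong λ i → trans (cong (λ bs → does (suc (toℕ i) ∈? bs)) (properPrefixSums-bump a as))
                                   (suc-∈?-map-suc (toℕ i) (properPrefixSums (a ∷ as))))
        (Des≡outside∷descents γ)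

-- An induction principle that removes one unit of the first part at a time. It follows the
-- recursion of `compositions` and, later, the removal of the first letter of a word.
data Built : ∀ {n} → Composition (suc n) → Set where
  one      : ∀ {pos eq} → Built (composition {1} (1 ∷ []) pos eq)
  prependᵇ : ∀ {n} {γ : Composition (suc n)} → Built γ → Built (prepend γ)
  bumpᵇ    : ∀ {n} {γ : Composition (suc n)} → Built γ → Built (bump γ)

built : ∀ {n} (γ : Composition (suc n)) → Built γ
built {zero}  (composition (1 ∷ []) (_ ∷ []) refl) = one
built {zero}  (composition (1 ∷ _ ∷ _) (_ ∷ s≤s _ ∷ _) ())
built {suc n} (composition (1 ∷ as) (_ ∷ pos) eq) =
  subst Built (parts-injective refl) (prependᵇ (built (composition as pos (suc-injective eq))))
built {suc n} (composition (suc (suc a) ∷ as) (_ ∷ pos) eq) =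
  subst Built (parts-injective refl)
    (bumpᵇ (built (composition (suc a ∷ as) (z<s ∷ pos) (suc-injective eq))))

-- `prepend` adds one part and one descent, `bump` adds neither. This makes the weight of `M β` in
-- `η` a function of the descent set alone.
ℓ≡1+∣descents∣ : ∀ {n} {γ : Composition (suc n)} → Built γ → ℓ γ ≡ suc ∣ descents γ ∣
ℓ≡1+∣descents∣ one = refl
ℓ≡1+∣descents∣ (prependᵇ {γ = γ} b) =
  trans (cong suc (ℓ≡1+∣descents∣ b)) (cong (suc ∘ ∣_∣) (sym (descents-prepend γ)))
ℓ≡1+∣descents∣ (bumpᵇ {γ = γ@(composition (a ∷ as) (_ ∷ _) _)} b) =
  trans (ℓ≡1+∣descents∣ b) (cong (suc ∘ ∣_∣) (sym (descents-bump γ)))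

-- Sorted words and their ascents.

-- The step into the entry numbered `toℕ i + 1` sits at position `i`, the place of that number in
-- `descents`, so that the two subsets can be compared directly.
ascents : ∀ {n} → Vec ℕ (suc n) → Subset n
ascents w = tabulate λ i → does (lookup w (inject₁ i) <? lookup w (suc i))

sorted-toList : ∀ {n} {w : Vec ℕ n} → Linked _≤_ w → Sorted (toList w)
sorted-toList []  = List.[]
sorted-toList [-] = List.[-]
sorted-toList {w = _ ∷ _ ∷ _} (x≤y ∷ w↗) = x≤y List.∷ sorted-toList w↗

linked-fromList : ∀ {m} → Sorted m → Linked _≤_ (fromList m)
linked-fromList List.[]         = []
linked-fromList List.[-]        = [-]
linked-fromList (x≤y List.∷ m↗) = x≤y ∷ linked-fromList m↗

-- Ascents depend on the order of the letters, while a monomial is a word up to permutation; the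
-- sorted word is the representative used throughout.
sortedWord : ∀ {n} m → length m ≡ n → ∃[ w ] Linked _≤_ {n} w × toList w ↭ m
sortedWord {n} m refl = subst (λ k → ∃[ w ] Linked _≤_ {k} w × toList w ↭ m) (↭-length (sort-↭ m))
  (fromList (sort m) , linked-fromList (sort-↗ m) ,
   ↭-trans (↭-reflexive (toList∘fromList (sort m))) (sort-↭ m))

↗↭↗⇒≡ : ∀ {m m′} → Sorted m → Sorted m′ → m ↭ m′ → m ≡ m′
↗↭↗⇒≡ m↗ m′↗ m↭m′ = Pointwise.Pointwise-≡⇒≡ (↗↭↗⇒≋ ≤-totalOrder m↗ m′↗ (↭⇒↭ₛ m↭m′))

toList-inj : ∀ {n} {s w : Vec ℕ n} → toList s ≡ toList w → s ≡ w
toList-inj {s = s} {w} eq = trans (sym (cast-is-id refl s)) (toList-injective refl s w eq)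

-- Monomials of `M β`: words cut into constant blocks.

length-powers : ∀ es s → length (powers es s) ≡ sum es
length-powers []       []      = refl
length-powers (e ∷ es) (i ∷ s) =
  trans (length-++ (replicate e i)) (cong₂ _+_ (length-replicate e) (length-powers es s))

-- A positive exponent puts the index at the front of its block, so the indices can be read off
-- block by block.
powers-injective : ∀ {es} → All (0 <_) es → ∀ s s′ → powers es s ≡ powers es s′ → s ≡ s′
powers-injective {[]}         []           []      []        eq = refl
powers-injective {suc e ∷ es} (s≤s _ ∷ ps) (i ∷ s) (i′ ∷ s′) eq with refl ← ∷-injectiveˡ eq =
  cong (i ∷_) (powers-injective ps s s′ (++-cancelˡ (replicate (suc e) i) _ _ eq))

sorted-replicate-++ : ∀ e {i m} → Sorted (i ∷ m) → Sorted (i ∷ replicate e i ++ m)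
sorted-replicate-++ zero    m↗ = m↗
sorted-replicate-++ (suc e) m↗ = ≤-refl List.∷ sorted-replicate-++ e m↗

powers-sorted : ∀ {es} → All (0 <_) es → ∀ {s} → StrictlyIncreasing s → Sorted (powers es s)
powers-sorted {[]} [] {[]} _ = List.[]
powers-sorted {suc e ∷ []} (_ ∷ []) {_ ∷ []} _ = sorted-replicate-++ e List.[-]
powers-sorted {suc e ∷ suc _ ∷ _} (_ ∷ ps@(s≤s _ ∷ _)) {_ ∷ _ ∷ _} (i<j ∷ s↗) =
  sorted-replicate-++ e (<⇒≤ i<j List.∷ powers-sorted ps s↗)

-- After `prepend` the first block has length one, so the first two letters lie in different blocks
-- and form a strict step. After `bump` they lie in the same block and are equal.
powers≡⇒descents : ∀ {n} {β : Composition (suc n)} → Built β → ∀ {s} (w : Vec ℕ (suc n)) →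
  StrictlyIncreasing s → powers (parts β) s ≡ toList w → descents β ≡ ascents w
powers≡⇒descents one {_ ∷ []} (_ ∷ []) _ _ = refl
powers≡⇒descents (prependᵇ {γ = γ@(composition (suc b ∷ bs) (_ ∷ _) _)} built-γ)
                 {i ∷ j ∷ s} (x ∷ y ∷ w) (i<j ∷ s↗) eq
  with refl ← ∷-injectiveˡ eq | eq′ ← ∷-injectiveʳ eq with refl ← ∷-injectiveˡ eq′ =
  trans (descents-prepend γ)
        (cong₂ _∷_ (sym (dec-true (x <? y) i<j)) (powers≡⇒descents built-γ (y ∷ w) s↗ eq′))
powers≡⇒descents (bumpᵇ {γ = γ@(composition (suc a ∷ as) (_ ∷ _) _)} built-γ) {i ∷ s} (x ∷ y ∷ w) s↗ eq
  with refl ← ∷-injectiveˡ eq | eq′ ← ∷-injectiveʳ eq with refl ← ∷-injectiveˡ eq′ =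
  trans (descents-bump γ)
        (cong₂ _∷_ (sym (dec-false (x <? x) (<-irrefl refl))) (powers≡⇒descents built-γ (x ∷ w) s↗ eq′))

does-true⇒ : ∀ {a} {A : Set a} (a? : Dec A) → does a? ≡ true → A
does-true⇒ (yes a) _ = a

does-false⇒¬ : ∀ {a} {A : Set a} (a? : Dec A) → does a? ≡ false → ¬ A
does-false⇒¬ (no ¬a) _ = ¬a

-- The word is cut into blocks at its ascents: a strict first step opens a new block for the first
-- letter, and otherwise that letter joins the block of the second.
descents≡⇒powers : ∀ {n} {β : Composition (suc n)} → Built β → ∀ {w : Vec ℕ (suc n)} → Linked _≤_ w →
  descents β ≡ ascents w → ∃[ s ] StrictlyIncreasing s × powers (parts β) s ≡ toList w
descents≡⇒powers one {x ∷ []} _ _ = x ∷ [] , [-] , refl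
descents≡⇒powers (prependᵇ {γ = γ@(composition (suc b ∷ bs) (_ ∷ _) _)} built-γ)
                 {x ∷ y ∷ w} (_ ∷ w↗) eq
  with eq′ ← trans (sym (descents-prepend γ)) eq
  with descents≡⇒powers built-γ w↗ (cong Vec.tail eq′)
-- The first part is positive, so the first index `j` is the first letter `y`.
... | j ∷ s , s↗ , eq″ with refl ← ∷-injectiveˡ eq″ =
  x ∷ j ∷ s , does-true⇒ (x <? y) (sym (cong Vec.head eq′)) ∷ s↗ , cong (x ∷_) eq″
descents≡⇒powers (bumpᵇ {γ = γ@(composition (suc a ∷ as) (_ ∷ _) _)} built-γ)
                 {x ∷ y ∷ w} (x≤y ∷ w↗) eq
  with eq′ ← trans (sym (descents-bump γ)) eq
  -- No ascent at the head excludes a strict step, so the weak one is an equality.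
  with refl ← ≤-antisym x≤y (≮⇒≥ (does-false⇒¬ (x <? y) (sym (cong Vec.head eq′))))
  with descents≡⇒powers built-γ w↗ (cong Vec.tail eq′)
... | j ∷ s , s↗ , eq″ with refl ← ∷-injectiveˡ eq″ = x ∷ s , s↗ , cong (x ∷_) eq″

-- Both words are sorted, so equality of monomials becomes equality of words, and the two preceding
-- lemmas apply.
powers-fibre : ∀ {n} (β : Composition (suc n)) {w} → Linked _≤_ w → ∀ {m} → toList w ↭ m →
  (∃[ s ] StrictlyIncreasing s × powers (parts β) s ↭ m) ⇔ (descents β ≡ ascents w)
powers-fibre β {w} w↗ w↭m = mk⇔
  (λ (s , s↗ , s↭m) → powers≡⇒descents (built β) w s↗
    (↗↭↗⇒≡ (powers-sorted (positive β) s↗) (sorted-toList w↗) (↭-trans s↭m (↭-sym w↭m))))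
  (λ eq → let s , s↗ , eq′ = descents≡⇒powers (built β) w↗ eq
          in s , s↗ , ↭-trans (↭-reflexive eq′) w↭m)

-- Monomials of `L γ`: strict steps at descents.

∈-ascents : ∀ {n} (w : Vec ℕ (suc n)) {k} → k ∈ˢ ascents w ⇔ (lookup w (inject₁ k) < lookup w (suc k))
∈-ascents w {k} = mk⇔
  (λ k∈ → does-true⇒ (_ <? _) (trans (sym (lookup∘tabulate _ k)) ([]=⇒lookup k∈)))
  (λ lt → lookup⇒[]= k (ascents w) (trans (lookup∘tabulate _ k) (dec-true (_ <? _) lt)))

increasingAlong⇔⊆ascents : ∀ {n} (γ : Composition (suc n)) {w} → Linked _≤_ w →
  IncreasingAlong γ w ⇔ (descents γ ⊆ˢ ascents w)
increasingAlong⇔⊆ascents γ {w} w↗ = mk⇔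
  (λ (_ , strict) {k} k∈ → Equivalence.from (∈-ascents w)
    (strict (inject₁ k) (suc k) (cong suc (toℕ-inject₁ k))
      (subst (suc k ∈ˢ_) (sym (Des≡outside∷descents γ)) (Vec.there k∈))))
  (λ D⊆ → w↗ , λ j k j+1≡k k∈ → strict D⊆ j k j+1≡k (subst (k ∈ˢ_) (Des≡outside∷descents γ) k∈))
  where
  strict : descents γ ⊆ˢ ascents w → ∀ j k → suc (toℕ j) ≡ toℕ k → k ∈ˢ outside ∷ descents γ →
           lookup w j < lookup w k
  strict D⊆ j (suc k) j+1≡k (Vec.there k∈)
    -- Consecutive positions have the form `inject₁ k`, `suc k`, which is the shape used by
    -- `ascents`.
    with refl ← toℕ-injective {i = j} {inject₁ k} (trans (suc-injective j+1≡k) (sym (toℕ-inject₁ k))) =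
    Equivalence.to (∈-ascents w) (D⊆ k∈)

sorted-unique : ∀ {n} {s w : Vec ℕ n} → Linked _≤_ s → Linked _≤_ w → toList s ↭ toList w → s ≡ w
sorted-unique s↗ w↗ s↭w = toList-inj (↗↭↗⇒≡ (sorted-toList s↗) (sorted-toList w↗) s↭w)

-- The only weakly increasing arrangement of the monomial is `w`, so it is enough to test `w`
-- itself.
toList-fibre : ∀ {n} (γ : Composition (suc n)) {w} → Linked _≤_ w → ∀ {m} → toList w ↭ m →
  (∃[ s ] IncreasingAlong γ s × toList s ↭ m) ⇔ (descents γ ⊆ˢ ascents w)
toList-fibre γ {w} w↗ w↭m = mk⇔ to
  (λ D⊆ → w , Equivalence.from (increasingAlong⇔⊆ascents γ w↗) D⊆ , w↭m)
  where
  to : (∃[ s ] IncreasingAlong γ s × toList s ↭ _) → descents γ ⊆ˢ ascents w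
  to (s , inc , s↭m) with refl ← sorted-unique (proj₁ inc) w↗ (↭-trans s↭m (↭-sym w↭m)) =
    Equivalence.to (increasingAlong⇔⊆ascents γ w↗) inc

-- Multiplicities as indicators.

module _ {S : Set} {P : S → Set} {mon : S → Monomial} (F : Summable P mon) {m : Monomial} where
  open Summable F

  multiplicity-none : ¬ (∃[ s ] P s × mon s ↭ m) → multiplicity m ≡ 0
  multiplicity-none none with fibre m in eq
  ... | []    = refl
  ... | s ∷ _ = contradiction (s , Equivalence.to ∈-fibre (subst (s ∈_) (sym eq) (here refl))) none

  -- The fibre lists the occurrences without repetition, so two entries would contradict uniqueness
  -- and an empty list would contradict existence.
  multiplicity-one : (∀ {s s′} → P s × mon s ↭ m → P s′ × mon s′ ↭ m → s ≡ s′) →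
                     (∃[ s ] P s × mon s ↭ m) → multiplicity m ≡ 1
  multiplicity-one unique (s , occurs)
    with fibre m | fibre-unique m | ∈-fibre {m} {s} | (λ {s} → Equivalence.to (∈-fibre {m} {s}))
  ... | []         | _               | s∈ | _   = contradiction (Equivalence.from s∈ occurs) λ ()
  ... | _ ∷ []     | _               | _  | _   = refl
  ... | t ∷ u ∷ _ | (t≢u ∷ _) ∷ _ | _  | to =
    contradiction (unique (to (here refl)) (to (there (here refl)))) t≢u

  multiplicity-dec : (∀ {s s′} → P s × mon s ↭ m → P s′ × mon s′ ↭ m → s ≡ s′) →
                     ∀ {q} {Q : Set q} → (∃[ s ] P s × mon s ↭ m) ⇔ Q → (Q? : Dec Q) →
                     multiplicity m ≡ (if does Q? then 1 else 0)
  multiplicity-dec unique iff (yes q) = multiplicity-one unique (Equivalence.from iff q)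
  multiplicity-dec unique iff (no ¬q) = multiplicity-none (¬q ∘ Equivalence.to iff)

_≟ˢ_ : ∀ {n} (p q : Subset n) → Dec (p ≡ q)
_≟ˢ_ = ≡-dec Bool._≟_

module _ {n} {w : Vec ℕ (suc n)} (w↗ : Linked _≤_ w) {m : Monomial} (w↭m : toList w ↭ m) where

  multiplicity-M : ∀ β → Summable.multiplicity (powers-summable β) m ≡
                         (if does (descents β ≟ˢ ascents w) then 1 else 0)
  multiplicity-M β = multiplicity-dec (powers-summable β)
    (λ {s} {s′} (s↗ , s↭m) (s′↗ , s′↭m) → powers-injective (positive β) s s′
      (↗↭↗⇒≡ (powers-sorted (positive β) s↗) (powers-sorted (positive β) s′↗)
             (↭-trans s↭m (↭-sym s′↭m))))
    (powers-fibre β w↗ w↭m) (descents β ≟ˢ ascents w)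

  multiplicity-L : ∀ γ → Summable.multiplicity (toList-summable γ) m ≡
                         (if does (descents γ ⊆? ascents w) then 1 else 0)
  multiplicity-L γ = multiplicity-dec (toList-summable γ)
    (λ ((s↗ , _) , s↭m) ((s′↗ , _) , s′↭m) → sorted-unique s↗ s′↗ (↭-trans s↭m (↭-sym s′↭m)))
    (toList-fibre γ w↗ w↭m) (descents γ ⊆? ascents w)

module _ {n} {m : Monomial} (length≢ : ¬ length m ≡ n) where

  -- Homogeneity settles the monomials of the wrong degree, which have no sorted word of the
  -- required length.
  multiplicity-M-degree : ∀ (β : Composition n) → Summable.multiplicity (powers-summable β) m ≡ 0
  multiplicity-M-degree β = multiplicity-none (powers-summable β) λ (s , _ , s↭m) →
    length≢ (trans (sym (↭-length s↭m)) (trans (length-powers (parts β) s) (sum≡n β)))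

  multiplicity-L-degree : ∀ (γ : Composition n) → Summable.multiplicity (toList-summable γ) m ≡ 0
  multiplicity-L-degree γ = multiplicity-none (toList-summable γ) λ (s , _ , s↭m) →
    length≢ (trans (sym (↭-length s↭m)) (length-toList s))

-- Finite sums over lists and over subsets.

module _ {c r} (𝐤 : CommutativeRing c r) where

  open CommutativeRing 𝐤
    using (Carrier; _≈_; 0#; 1#; setoid; ring; +-cong; +-congˡ; *-cong; *-congˡ;
           +-identityˡ; +-identityʳ; *-identityˡ; *-identityʳ; zeroˡ; zeroʳ; distribˡ; distribʳ;
           +-assoc; *-assoc; *-commutativeSemigroup; -_; -‿inverseˡ; reflexive)
    renaming (_+_ to _⊞_; _*_ to _⊠_; refl to ≈-refl; sym to ≈-sym; trans to ≈-trans)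
  open RingProperties ring using (-1*x≈-x)
  open CommutativeSemigroupProperties *-commutativeSemigroup using (x∙yz≈y∙xz)
  open QuasisymmetricFunctions 𝐤
  open import Relation.Binary.Reasoning.Setoid setoid

  [_] : Bool → Carrier
  [ b ] = if b then 1# else 0#

  Σᴸ : ∀ {a} {A : Set a} → List A → (A → Carrier) → Carrier
  Σᴸ xs f = foldr (λ x acc → f x ⊞ acc) 0# xs

  module _ {a} {A : Set a} where

    coeff-∑ : ∀ (xs : List A) f m → coeff (∑ xs f) m ≡ Σᴸ xs (λ x → coeff (f x) m)
    coeff-∑ []       f m = refl
    coeff-∑ (x ∷ xs) f m = cong (coeff (f x) m ⊞_) (coeff-∑ xs f m)

    Σᴸ-cong : ∀ {f g : A → Carrier} xs → (∀ x → f x ≈ g x) → Σᴸ xs f ≈ Σᴸ xs g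
    Σᴸ-cong []       f≈g = ≈-refl
    Σᴸ-cong (x ∷ xs) f≈g = +-cong (f≈g x) (Σᴸ-cong xs f≈g)

    Σᴸ-zero : ∀ {f : A → Carrier} xs → (∀ x → f x ≈ 0#) → Σᴸ xs f ≈ 0#
    Σᴸ-zero []       f≈0 = ≈-refl
    Σᴸ-zero (x ∷ xs) f≈0 = ≈-trans (+-cong (f≈0 x) (Σᴸ-zero xs f≈0)) (+-identityˡ 0#)

    Σᴸ-++ : ∀ (f : A → Carrier) xs ys → Σᴸ (xs ++ ys) f ≈ Σᴸ xs f ⊞ Σᴸ ys f
    Σᴸ-++ f []       ys = ≈-sym (+-identityˡ _)
    Σᴸ-++ f (x ∷ xs) ys = ≈-trans (+-congˡ (Σᴸ-++ f xs ys)) (≈-sym (+-assoc _ _ _))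

    Σᴸ-map : ∀ {b} {B : Set b} (g : B → A) (f : A → Carrier) xs → Σᴸ (map g xs) f ≡ Σᴸ xs (f ∘ g)
    Σᴸ-map g f []       = refl
    Σᴸ-map g f (x ∷ xs) = cong (f (g x) ⊞_) (Σᴸ-map g f xs)

    Σᴸ-filter : ∀ {p} {P : A → Set p} (P? : Decidable P) (f : A → Carrier) xs →
                Σᴸ (filter P? xs) f ≈ Σᴸ xs (λ x → [ does (P? x) ] ⊠ f x)
    Σᴸ-filter P? f []       = ≈-refl
    Σᴸ-filter P? f (x ∷ xs) with does (P? x)
    ... | true  = +-cong (≈-sym (*-identityˡ _)) (Σᴸ-filter P? f xs)
    ... | false = ≈-trans (Σᴸ-filter P? f xs)
                          (≈-trans (≈-sym (+-identityˡ _)) (+-cong (≈-sym (zeroˡ _)) ≈-refl))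

  -- Splitting on the first element, `inside` before `outside`, matches the order in which
  -- `compositions` lists the results of `prepend` and `bump`.
  Σˢ : ∀ n → (Subset n → Carrier) → Carrier
  Σˢ zero    f = f []
  Σˢ (suc n) f = Σˢ n (f ∘ (inside ∷_)) ⊞ Σˢ n (f ∘ (outside ∷_))

  Σˢ-cong : ∀ n {f g} → (∀ B → f B ≈ g B) → Σˢ n f ≈ Σˢ n g
  Σˢ-cong zero    f≈g = f≈g []
  Σˢ-cong (suc n) f≈g = +-cong (Σˢ-cong n (λ B → f≈g (inside ∷ B))) (Σˢ-cong n (λ B → f≈g (outside ∷ B)))

  Σˢ-zero : ∀ n {f} → (∀ B → f B ≈ 0#) → Σˢ n f ≈ 0#
  Σˢ-zero zero    f≈0 = f≈0 []
  Σˢ-zero (suc n) f≈0 =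
    ≈-trans (+-cong (Σˢ-zero n (λ B → f≈0 (inside ∷ B))) (Σˢ-zero n (λ B → f≈0 (outside ∷ B))))
            (+-identityˡ 0#)

  Σˢ-*ˡ : ∀ n a f → Σˢ n (λ B → a ⊠ f B) ≈ a ⊠ Σˢ n f
  Σˢ-*ˡ zero    a f = ≈-refl
  Σˢ-*ˡ (suc n) a f =
    ≈-trans (+-cong (Σˢ-*ˡ n a (f ∘ (inside ∷_))) (Σˢ-*ˡ n a (f ∘ (outside ∷_))))
            (≈-sym (distribˡ a _ _))

  -- This is the bijection between compositions and descent sets, used as a change of summation
  -- index: `prepend` gives the subsets containing the first element, `bump` those avoiding it.
  Σᴸ-compositions : ∀ n (f : Subset n → Carrier) →
                    Σᴸ (compositions (suc n)) (f ∘ descents) ≈ Σˢ n f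
  Σᴸ-compositions zero    f = +-identityʳ _
  Σᴸ-compositions (suc n) f = begin
    Σᴸ (map prepend γs ++ map bump γs) (f ∘ descents)
      ≈⟨ Σᴸ-++ (f ∘ descents) (map prepend γs) (map bump γs) ⟩
    Σᴸ (map prepend γs) (f ∘ descents) ⊞ Σᴸ (map bump γs) (f ∘ descents)
      ≡⟨ cong₂ _⊞_ (Σᴸ-map prepend _ γs) (Σᴸ-map bump _ γs) ⟩
    Σᴸ γs (f ∘ descents ∘ prepend) ⊞ Σᴸ γs (f ∘ descents ∘ bump)
      ≈⟨ +-cong (Σᴸ-cong γs (λ γ → reflexive (cong f (descents-prepend γ))))
                (Σᴸ-cong γs (λ γ → reflexive (cong f (descents-bump γ)))) ⟩
    Σᴸ γs (f ∘ (inside ∷_) ∘ descents) ⊞ Σᴸ γs (f ∘ (outside ∷_) ∘ descents)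
      ≈⟨ +-cong (Σᴸ-compositions n _) (Σᴸ-compositions n _) ⟩
    Σˢ (suc n) f ∎
    where γs = compositions (suc n)

  -- At each element only the half of the sum that agrees with `T` there survives.
  Σˢ-δ : ∀ {n} (T : Subset n) (g : Subset n → Carrier) → Σˢ n (λ B → g B ⊠ [ does (B ≟ˢ T) ]) ≈ g T
  Σˢ-δ []            g = *-identityʳ _
  Σˢ-δ {suc n} (inside  ∷ T) g =
    ≈-trans (+-cong (Σˢ-δ T (g ∘ (inside ∷_))) (Σˢ-zero n λ B → zeroʳ _)) (+-identityʳ _)
  Σˢ-δ {suc n} (outside ∷ T) g =
    ≈-trans (+-cong (Σˢ-zero n λ B → zeroʳ _) (Σˢ-δ T (g ∘ (outside ∷_)))) (+-identityˡ _)

  -- The left side factors as the product of 1 + (-1)^[t ∉ A] over t ∈ T.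
  Σˢ-signed : ∀ {n} (A T : Subset n) →
    Σˢ n (λ B → -1# ^ ∣ B ─ A ∣ ⊠ [ does (B ⊆? T) ]) ≈ [ does (T ⊆? A) ] ⊠ 2# ^ ∣ T ∣
  Σˢ-signed []            []            = ≈-refl
  -- If the first element is not in `T`, a `B` containing it is not a subset of `T`, and that half
  -- vanishes.
  Σˢ-signed {suc n} (inside  ∷ A) (outside ∷ T) =
    ≈-trans (+-cong (Σˢ-zero n λ B → zeroʳ _) (Σˢ-signed A T)) (+-identityˡ _)
  Σˢ-signed {suc n} (outside ∷ A) (outside ∷ T) =
    ≈-trans (+-cong (Σˢ-zero n λ B → zeroʳ _) (Σˢ-signed A T)) (+-identityˡ _)
  -- An element of both `T` and `A` does not affect the sign, so the halves agree and give a factor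
  -- 2.
  Σˢ-signed {suc n} (inside  ∷ A) (inside  ∷ T) = begin
    S ⊞ S                                        ≈⟨ +-cong (≈-sym (*-identityˡ S)) (≈-sym (*-identityˡ S)) ⟩
    1# ⊠ S ⊞ 1# ⊠ S                              ≈⟨ distribʳ S 1# 1# ⟨
    2# ⊠ S                                       ≈⟨ *-congˡ (Σˢ-signed A T) ⟩
    2# ⊠ ([ does (T ⊆? A) ] ⊠ 2# ^ ∣ T ∣)        ≈⟨ x∙yz≈y∙xz 2# _ _ ⟩
    [ does (T ⊆? A) ] ⊠ (2# ⊠ 2# ^ ∣ T ∣)        ∎
    where
    S = Σˢ n (λ B → -1# ^ ∣ B ─ A ∣ ⊠ [ does (B ⊆? T) ])
  -- An element of `T` outside `A` flips the sign, so the halves cancel; on the right, `T` fails to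
  -- lie in `A`.
  Σˢ-signed {suc n} (outside ∷ A) (inside  ∷ T) = begin
    Σˢ n (λ B → (-1# ⊠ -1# ^ ∣ B ─ A ∣) ⊠ [ does (B ⊆? T) ]) ⊞ S
      ≈⟨ +-cong (≈-trans (Σˢ-cong n (λ B → *-assoc _ _ _)) (Σˢ-*ˡ n -1# _)) ≈-refl ⟩
    -1# ⊠ S ⊞ S             ≈⟨ +-cong (-1*x≈-x S) ≈-refl ⟩
    - S ⊞ S                 ≈⟨ -‿inverseˡ S ⟩
    0#                      ≈⟨ zeroˡ _ ⟨
    0# ⊠ (2# ⊠ 2# ^ ∣ T ∣)  ∎
    where
    S = Σˢ n (λ B → -1# ^ ∣ B ─ A ∣ ⊠ [ does (B ⊆? T) ])

  -- Coefficients of the two sides and their comparison.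

  ∑ᵐ-coeff : ∀ {S P mon} (F : Summable {S} P mon) {m} b →
             Summable.multiplicity F m ≡ (if b then 1 else 0) → coeff (∑ᵐ F) m ≈ [ b ]
  ∑ᵐ-coeff F b     eq rewrite eq with b
  ... | true  = +-identityʳ 1#
  ... | false = ≈-refl

  η-coeff-degree : ∀ {n m} → ¬ length m ≡ n → (α : Composition n) → coeff (η α) m ≈ 0#
  η-coeff-degree {n} {m} length≢ α =
    ≈-trans (reflexive (coeff-∑ βs _ m))
            (Σᴸ-zero βs λ β → ≈-trans
              (*-congˡ (∑ᵐ-coeff (powers-summable β) false (multiplicity-M-degree length≢ β)))
              (zeroʳ _))
    where βs = filter (λ β → Des β ⊆? Des α) (compositions n)

  ∑L-coeff-degree : ∀ {n m} → ¬ length m ≡ n → (a : Composition n → Carrier) →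
                    coeff (∑ (compositions n) (λ γ → a γ · L γ)) m ≈ 0#
  ∑L-coeff-degree {n} {m} length≢ a =
    ≈-trans (reflexive (coeff-∑ (compositions n) _ m))
            (Σᴸ-zero (compositions n) λ γ → ≈-trans
              (*-congˡ (∑ᵐ-coeff (toList-summable γ) false (multiplicity-L-degree length≢ γ)))
              (zeroʳ _))

  module _ {n} {w : Vec ℕ (suc n)} (w↗ : Linked _≤_ w) {m : Monomial} (w↭m : toList w ↭ m)
           (α : Composition (suc n)) where

    private
      A = descents α
      T = ascents w

    η-coeff : coeff (η α) m ≈ 2# ⊠ ([ does (T ⊆? A) ] ⊠ 2# ^ ∣ T ∣)
    η-coeff = begin
      coeff (η α) m
        ≡⟨ coeff-∑ (filter (λ β → Des β ⊆? Des α) (compositions (suc n))) _ m ⟩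
      Σᴸ (filter (λ β → Des β ⊆? Des α) (compositions (suc n))) (λ β → 2# ^ ℓ β ⊠ coeff (M β) m)
        ≈⟨ Σᴸ-filter (λ β → Des β ⊆? Des α) _ (compositions (suc n)) ⟩
      Σᴸ (compositions (suc n)) (λ β → [ does (Des β ⊆? Des α) ] ⊠ (2# ^ ℓ β ⊠ coeff (M β) m))
        ≈⟨ Σᴸ-cong (compositions (suc n)) term ⟩
      Σᴸ (compositions (suc n)) ((λ B → g B ⊠ [ does (B ≟ˢ T) ]) ∘ descents)
        ≈⟨ Σᴸ-compositions n _ ⟩
      Σˢ n (λ B → g B ⊠ [ does (B ≟ˢ T) ])
        ≈⟨ Σˢ-δ T g ⟩
      g T
        ≈⟨ x∙yz≈y∙xz _ 2# _ ⟩
      2# ⊠ ([ does (T ⊆? A) ] ⊠ 2# ^ ∣ T ∣) ∎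
      where
      g : Subset n → Carrier
      -- The `suc` is the excess of the length over the number of descents; it yields the factor 2
      -- of the theorem.
      g B = [ does (B ⊆? A) ] ⊠ 2# ^ suc ∣ B ∣

      term : ∀ β → [ does (Des β ⊆? Des α) ] ⊠ (2# ^ ℓ β ⊠ coeff (M β) m) ≈
                   g (descents β) ⊠ [ does (descents β ≟ˢ T) ]
      term β = ≈-trans
        -- Both descent sets begin with `outside`, so dropping that position does not change the
        -- inclusion test.
        (*-cong (reflexive (cong₂ (λ B C → [ does (B ⊆? C) ])
                                   (Des≡outside∷descents β) (Des≡outside∷descents α)))
                (*-cong (reflexive (cong (2# ^_) (ℓ≡1+∣descents∣ (built β))))
                        (∑ᵐ-coeff (powers-summable β) _ (multiplicity-M w↗ w↭m β))))
        (≈-sym (*-assoc _ _ _))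

    ∑L-coeff : coeff (∑ (compositions (suc n)) (λ γ → -1# ^ ∣ Des γ ─ Des α ∣ · L γ)) m ≈
               [ does (T ⊆? A) ] ⊠ 2# ^ ∣ T ∣
    ∑L-coeff = begin
      coeff (∑ (compositions (suc n)) (λ γ → -1# ^ ∣ Des γ ─ Des α ∣ · L γ)) m
        ≡⟨ coeff-∑ (compositions (suc n)) _ m ⟩
      Σᴸ (compositions (suc n)) (λ γ → -1# ^ ∣ Des γ ─ Des α ∣ ⊠ coeff (L γ) m)
        ≈⟨ Σᴸ-cong (compositions (suc n)) (λ γ → *-cong
             (reflexive (cong₂ (λ B C → -1# ^ ∣ B ─ C ∣)
                                (Des≡outside∷descents γ) (Des≡outside∷descents α)))
             (∑ᵐ-coeff (toList-summable γ) _ (multiplicity-L w↗ w↭m γ))) ⟩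
      Σᴸ (compositions (suc n)) ((λ B → -1# ^ ∣ B ─ A ∣ ⊠ [ does (B ⊆? T) ]) ∘ descents)
        ≈⟨ Σᴸ-compositions n _ ⟩
      Σˢ n (λ B → -1# ^ ∣ B ─ A ∣ ⊠ [ does (B ⊆? T) ])
        ≈⟨ Σˢ-signed A T ⟩
      [ does (T ⊆? A) ] ⊠ 2# ^ ∣ T ∣ ∎

  signed-expansion : ∀ {n} (α : Composition (suc n)) m → Dec (length m ≡ suc n) →
    coeff (η α) m ≈ 2# ⊠ coeff (∑ (compositions (suc n)) (λ γ → -1# ^ ∣ Des γ ─ Des α ∣ · L γ)) m
  signed-expansion α m (yes length≡) =
    let w , w↗ , w↭m = sortedWord m length≡
    in ≈-trans (η-coeff w↗ w↭m α) (*-congˡ (≈-sym (∑L-coeff w↗ w↭m α)))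
  signed-expansion α m (no length≢) =
    ≈-trans (η-coeff-degree length≢ α)
            (≈-sym (≈-trans (*-congˡ (∑L-coeff-degree length≢ _)) (zeroʳ 2#)))

proposition5 : ∀ {c r} (𝐤 : CommutativeRing c r) (n : ℕ) .{{_ : NonZero n}} (α : Composition n) →
    let open QuasisymmetricFunctions 𝐤 in
    η α ≋ 2# · ∑ (compositions n) (λ γ → -1# ^ ∣ Des γ ─ Des α ∣ · L γ)
proposition5 𝐤 (suc n) α m = signed-expansion 𝐤 α m (length m ≟ suc n)
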